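{- Let $G$ be a finite bipartite graph. Then $\gamma(G)=\gamma_{\mathrm{m}}^{\infty}(G)=2$ if and only if $G\in\mathfrak{C}$, where $\mathfrak{C}$ is the class of all graphs obtained either from $K_{m,m}$, $m\geq 2$, by deleting (the edges of) a matching of size $k$, where $0\leq k\leq m$, or from $K_{m,n}$, $n>m\geq 2$, by deleting (the edges of) a matching of size $\ell$, where $0\leq \ell\leq m-1$.
   Context: All graphs are finite, simple and undirected. A dominating set of $G=(V,E)$ is a set $D\subseteq V$ such that every vertex of $V-D$ is adjacent to a vertex of $D$; $\gamma(G)$ is the minimum size of a dominating set. m-eternal domination ("all guards move"): a defender chooses a set $D_1\subseteq V$ and places one guard on each vertex of $D_1$. Then, for $i=1,2,\ldots$ in turn, an attacker (knowing the current position) chooses a vertex $r_i\in V-D_i$, and the defender responds with a set $D_{i+1}$ with $|D_{i+1}|=|D_i|$ and $r_i\in D_{i+1}$, obtained from $D_i$ by letting each guard either stay in place or move to an adjacent vertex (i.e. there is a bijection $f:D_i\to D_{i+1}$ with $f(v)=v$ or $f(v)$ adjacent to $v$ for each $v\in D_i$). Every $D_i$ must be a dominating set. $D_1$ is an m-eternal dominating set if the defender, starting from $D_1$, can respond in this way forever to every infinite sequence of attacks. $\gamma_{\mathrm{m}}^{\infty}(G)$ is the minimum size of an m-eternal dominating set of $G$.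
   Formalization: The graph G is additionally assumed to have at least four vertices; without this the claim fails for two isolated vertices and for K_1 ∪ K_2, where both numbers equal 2 although every graph in the class has at least four vertices. -}

module Defs where

open import Data.Bool.Base using (Bool)
open import Data.Fin.Base using (Fin)
import Data.Fin.Properties as Fin
open import Data.Fin.Subset using (Subset; _∈_; _∉_; ∣_∣)
open import Data.List.Base using (List; []; _∷_; length)
import Data.List.Membership.Propositional as List
import Data.List.Membership.DecPropositional as DecMembership
open import Data.List.Relation.Unary.All using (All)
open import Data.List.Relation.Unary.AllPairs using (AllPairs)
open import Data.Nat.Base using (ℕ; _≤_; _<_; _∸_)
open import Data.Product.Base using (Σ-syntax; ∃; ∃-syntax; _×_; _,_; proj₁; proj₂)
import Data.Product.Properties as Product
open import Data.Sum.Base using (_⊎_; inj₁; inj₂)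
import Data.Sum.Properties as Sum
open import Function.Base using (_∘_)
open import Function.Bundles using (_⤖_; _⇔_; module Bijection)
open import Level using (0ℓ)
open import Relation.Binary.Core using (Rel)
open import Relation.Binary.Definitions
  using (Symmetric; Irreflexive; Decidable; DecidableEquality)
open import Relation.Binary.PropositionalEquality using (_≡_; _≢_; refl)
open import Relation.Nullary.Decidable using (yes; no; _×-dec_; ¬?)

record Graph (V : Set) : Set₁ where
  field
    Adj    : Rel V 0ℓ
    adj?   : Decidable Adj
    sym    : Symmetric Adj
    irrefl : Irreflexive _≡_ Adj

open Graph public

infix 4 _≅_

_≅_ : {V W : Set} → Graph V → Graph W → Set
_≅_ {V} {W} G H = Σ[ φ ∈ V ⤖ W ] (∀ u v → Adj G u v ⇔ Adj H (Bijection.to φ u) (Bijection.to φ v))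

Bipartite : {V : Set} → Graph V → Set
Bipartite {V} G = Σ[ side ∈ (V → Bool) ] (∀ u v → Adj G u v → side u ≢ side v)

MinimumSize : {n : ℕ} → (Subset n → Set) → ℕ → Set
MinimumSize P k = (∃[ D ] (P D × ∣ D ∣ ≡ k)) × (∀ D → P D → k ≤ ∣ D ∣)

module _ {n : ℕ} (G : Graph (Fin n)) where

  Dominating : Subset n → Set
  Dominating D = ∀ v → v ∉ D → ∃[ u ] (u ∈ D × Adj G v u)

  record Move (D D′ : Subset n) : Set where
    field
      same-size : ∣ D′ ∣ ≡ ∣ D ∣
      move      : (∃[ v ] v ∈ D) ⤖ (∃[ v ] v ∈ D′)
      step      : ∀ g → proj₁ (Bijection.to move g) ≡ proj₁ g
                      ⊎ Adj G (proj₁ g) (proj₁ (Bijection.to move g))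

  -- A strategy gives the position of the guards after any finite history of
  -- attacks, most recent attack first.
  Strategy : Set
  Strategy = List (Fin n) → Subset n

  -- Histories in which every attack was on a vertex unoccupied at the time.
  data Legal (σ : Strategy) : List (Fin n) → Set where
    []  : Legal σ []
    _∷_ : ∀ {r h} → r ∉ σ h → Legal σ h → Legal σ (r ∷ h)

  -- Responding forever means responding correctly in every round of every
  -- play, that is, after every legal finite history.
  record MEternalDominating (D : Subset n) : Set where
    field
      strategy   : Strategy
      start      : strategy [] ≡ D
      dominating : ∀ {h} → Legal strategy h → Dominating (strategy h)
      occupy     : ∀ {h r} → Legal strategy h → r ∉ strategy h → r ∈ strategy (r ∷ h)
      respond    : ∀ {h r} → Legal strategy h → r ∉ strategy h →
                   Move (strategy h) (strategy (r ∷ h))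

  -- The numbers γ and γₘ^∞ are given as relations: "γ G k" says that the
  -- domination number of G is k.
  γ : ℕ → Set
  γ = MinimumSize Dominating

  γₘ^∞ : ℕ → Set
  γₘ^∞ = MinimumSize MEternalDominating

data KAdj {m n : ℕ} : Rel (Fin m ⊎ Fin n) 0ℓ where
  l-r : ∀ {i j} → KAdj (inj₁ i) (inj₂ j)
  r-l : ∀ {i j} → KAdj (inj₂ j) (inj₁ i)

K : (m n : ℕ) → Graph (Fin m ⊎ Fin n)
K m n = record
  { Adj    = KAdj
  ; adj?   = λ where
      (inj₁ _) (inj₁ _) → no λ ()
      (inj₁ _) (inj₂ _) → yes l-r
      (inj₂ _) (inj₁ _) → yes r-l
      (inj₂ _) (inj₂ _) → no λ ()
  ; sym    = λ where
      l-r → r-l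
      r-l → l-r
  ; irrefl = λ where
      refl ()
  }

-- A list of edges stands for a set of edges; each edge is listed with its ends
-- in some order.
module _ {V : Set} where

  Disjoint : Rel (V × V) 0ℓ
  Disjoint (a , b) (c , d) = (a ≢ c × a ≢ d) × (b ≢ c × b ≢ d)

  -- Disjointness also prevents an edge from being listed twice, so the length
  -- of the list is the size of the matching.
  IsMatching : Graph V → List (V × V) → Set
  IsMatching G M = All (λ (a , b) → Adj G a b) M × AllPairs Disjoint M

  delete : DecidableEquality V → Graph V → List (V × V) → Graph V
  delete _≟_ G M = record
    { Adj    = λ u v → Adj G u v × (u , v) List.∉ M × (v , u) List.∉ M
    ; adj?   = λ u v → adj? G u v ×-dec ¬? ((u , v) ∈? M) ×-dec ¬? ((v , u) ∈? M)
    ; sym    = λ (uv , ∉₁ , ∉₂) → sym G uv , ∉₂ , ∉₁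
    ; irrefl = λ u≡v → irrefl G u≡v ∘ proj₁
    }
    where open DecMembership (Product.≡-dec _≟_ _≟_) using (_∈?_)

infix 5 K[_,_]-_

K[_,_]-_ : (m n : ℕ) → List ((Fin m ⊎ Fin n) × (Fin m ⊎ Fin n)) → Graph (Fin m ⊎ Fin n)
K[ m , n ]- M = delete (Sum.≡-dec Fin._≟_ Fin._≟_) (K m n) M

data ℭ {V : Set} (G : Graph V) : Set where

  equal : ∀ m k M → 2 ≤ m → k ≤ m →
          IsMatching (K m m) M → length M ≡ k →
          G ≅ K[ m , m ]- M → ℭ G

  unequal : ∀ m n ℓ M → 2 ≤ m → m < n → ℓ ≤ m ∸ 1 →
            IsMatching (K m n) M → length M ≡ ℓ →
            G ≅ K[ m , n ]- M → ℭ G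

{-# OPTIONS --safe #-}
module Submission where

-- If two guards defend G, then, attacking r once, every vertex r lies in a
-- dominating pair.  In a bipartite graph whose larger side B has at least three
-- vertices, the partner a of b ∈ B lies in the other side A, is adjacent to all
-- of B - b, and b is adjacent to all of A - a.  Hence the missing edges between
-- A and B form a matching, and if |A| < |B|, the partner of a vertex of B outside
-- this matching is outside it as well.  Conversely, in a graph of ℭ every v has a
-- mate on the other side (its partner in the deleted matching, or an unmatched
-- vertex if v is unmatched) with {v, mate v} dominating, and the guards can
-- answer every attack r by moving to {r, mate r}.

open import Defs hiding (sym)
open import Data.Bool.Base using (Bool; true; false)
open import Data.Bool.Properties using (¬-not)
open import Data.Fin.Base using (Fin; zero; suc)
open import Data.Fin.Properties using (_≟_; any?; injective⇒≤; ¬∀⟶∃¬)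
open import Data.Fin.Subset using (Subset; _∈_; _∉_; ∣_∣; ⁅_⁆; _∪_)
open import Data.Fin.Subset.Properties
  using (_∈?_; x∈⁅x⁆; x∈⁅y⁆⇒x≡y; ∣⁅x⁆∣≡1; x∈p∪q⁻; x∈p∪q⁺; ∪-identityˡ; ∪-identityʳ; ∪-comm;
         p⊆q⇒∣p∣≤∣q∣; p⊂q⇒∣p∣<∣q∣)
open import Data.List.Base
  using (List; []; _∷_; length; map; lookup; filter; cartesianProduct; allFin)
open import Data.List.Membership.Propositional using () renaming (_∈_ to _∈ₗ_; _∉_ to _∉ₗ_)
import Data.List.Membership.DecPropositional as DecMembership
open import Data.List.Membership.Propositional.Properties
  using (∈-map⁺; ∈-map⁻; ∈-filter⁺; ∈-filter⁻; ∈-cartesianProduct⁺; ∈-allFin; ∈-lookup)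
import Data.List.Membership.Setoid.Properties as SetoidMembership
open import Data.List.Properties using (length-map)
open import Data.List.Relation.Unary.All as All using (All; []; _∷_)
import Data.List.Relation.Unary.All.Properties as All
open import Data.List.Relation.Unary.AllPairs as AllPairs using (AllPairs; []; _∷_)
import Data.List.Relation.Unary.AllPairs.Properties as AllPairs
open import Data.List.Relation.Unary.Any using (here; there; index)
open import Data.List.Relation.Unary.Unique.Propositional using (Unique)
import Data.List.Relation.Unary.Unique.Propositional.Properties as Unique
open import Data.Nat.Base using (ℕ; suc; zero; _+_; _≤_; _<_; s≤s; s≤s⁻¹)
open import Data.Nat.Properties
  using (≤-reflexive; ≤-trans; <-≤-trans; ≤-<-trans; <⇒≱; <⇒≤; ≤-total; m≤n⇒m<n∨m≡n; +-suc;
         +-comm; ∸-monoˡ-≤; _≤?_; ≰⇒>; +-cancelʳ-≤; +-monoʳ-≤)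
open import Data.Product.Base using (∃-syntax; Σ-syntax; _×_; _,_; proj₁; proj₂)
open import Data.Sum.Base as Sum using (_⊎_; inj₁; inj₂; [_,_]′)
open import Data.Sum.Properties using (inj₁-injective; inj₂-injective; ≡-dec)
open import Data.Sum.Algebra using (⊎-comm)
open import Data.Vec.Properties.WithK using ([]=-irrelevant)
open import Function.Base using (_∘_; id; case_of_)
open import Function.Bundles
  using (_⇔_; mk⇔; mk⤖; _↔_; mk↔ₛ′; module Bijection; module Equivalence; module Inverse)
open import Function.Construct.Composition using (_⤖-∘_; _⇔-∘_; _↔-∘_)
open import Function.Construct.Identity using (⤖-id)
open import Function.Properties.Inverse using (↔⇒⤖)
open import Relation.Binary.Definitions using (DecidableEquality)
open import Relation.Binary.PropositionalEquality
  using (_≡_; _≢_; refl; sym; trans; cong; subst; subst₂; setoid)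
open import Relation.Nullary using (¬_; yes; no; contradiction)
open import Relation.Nullary.Decidable using (_×-dec_; ¬?; decidable-stable)

-- Pigeonhole for lists over a finite type.

module _ {n : ℕ} where

  open DecMembership (_≟_ {n}) public using () renaming (_∈?_ to _∈ₗ?_)

  -- Otherwise the position of each `i` in `xs` would inject `Fin n` into `Fin (length xs)`.
  ∃-∉ : (xs : List (Fin n)) → length xs < n → ∃[ i ] i ∉ₗ xs
  ∃-∉ xs short = ¬∀⟶∃¬ n (_∈ₗ xs) (_∈ₗ? xs) λ all →
    <⇒≱ short (injective⇒≤ {f = index ∘ all}
      (SetoidMembership.index-injective (setoid _) (all _) (all _)))

lookup-injective : {A : Set} {xs : List A} → Unique xs →
                   ∀ i j → lookup xs i ≡ lookup xs j → i ≡ j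
lookup-injective (_ ∷ _)    zero    zero    _  = refl
lookup-injective (x∉ ∷ _)   zero    (suc j) eq = contradiction eq (All.lookup x∉ (∈-lookup j))
lookup-injective (x∉ ∷ _)   (suc i) zero    eq = contradiction (sym eq) (All.lookup x∉ (∈-lookup i))
lookup-injective (_ ∷ uniq) (suc i) (suc j) eq = cong suc (lookup-injective uniq i j eq)

unique⇒length≤ : ∀ {n} {xs : List (Fin n)} → Unique xs → length xs ≤ n
unique⇒length≤ uniq = injective⇒≤ (lookup-injective uniq _ _)

unique-∉⇒length< : ∀ {n} {xs : List (Fin n)} {i} → Unique xs → i ∉ₗ xs → length xs < n
unique-∉⇒length< {xs = xs} uniq i∉ = unique⇒length≤ (All.¬Any⇒All¬ xs i∉ ∷ uniq)

image-injective : {A B : Set} {f : A → B} {xs : List A} {x y : A} → Unique (map f xs) →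
                  x ∈ₗ xs → y ∈ₗ xs → f x ≡ f y → x ≡ y
image-injective _          (here refl) (here refl) _  = refl
image-injective {f = f} (x∉ ∷ _) (here refl) (there y∈) eq =
  contradiction eq (All.lookup x∉ (∈-map⁺ f y∈))
image-injective {f = f} (x∉ ∷ _) (there x∈) (here refl) eq =
  contradiction (sym eq) (All.lookup x∉ (∈-map⁺ f x∈))
image-injective (_ ∷ uniq) (there x∈)  (there y∈)  eq = image-injective uniq x∈ y∈ eq

unique⇒allPairs : {A : Set} {R : A → A → Set} {xs : List A} → Unique xs →
                  (∀ {x y} → x ∈ₗ xs → y ∈ₗ xs → x ≢ y → R x y) → AllPairs R xs
unique⇒allPairs []          _ = []
unique⇒allPairs (x∉ ∷ uniq) r =
  All.tabulate (λ y∈ → r (here refl) (there y∈) (All.lookup x∉ y∈)) ∷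
  unique⇒allPairs uniq (λ x∈ y∈ → r (there x∈) (there y∈))

-- Two-element sets of vertices.

pair : ∀ {p} → Fin p → Fin p → Subset p
pair u w = ⁅ u ⁆ ∪ ⁅ w ⁆

module _ {p : ℕ} {u w : Fin p} where

  ∈-pairˡ : u ∈ pair u w
  ∈-pairˡ = x∈p∪q⁺ (inj₁ (x∈⁅x⁆ u))

  ∈-pairʳ : w ∈ pair u w
  ∈-pairʳ = x∈p∪q⁺ (inj₂ (x∈⁅x⁆ w))

  ∈-pair⁻ : ∀ {x} → x ∈ pair u w → x ≡ u ⊎ x ≡ w
  ∈-pair⁻ = Sum.map (x∈⁅y⁆⇒x≡y u) (x∈⁅y⁆⇒x≡y w) ∘ x∈p∪q⁻ ⁅ u ⁆ ⁅ w ⁆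

∣pair∣≡2 : ∀ {p} {u w : Fin p} → u ≢ w → ∣ pair u w ∣ ≡ 2
∣pair∣≡2 {u = zero}  {zero}  u≢w = contradiction refl u≢w
∣pair∣≡2 {u = zero}  {suc w} _   =
  cong suc (trans (cong ∣_∣ (∪-identityˡ ⁅ w ⁆)) (∣⁅x⁆∣≡1 w))
∣pair∣≡2 {u = suc u} {zero}  _   =
  cong suc (trans (cong ∣_∣ (∪-identityʳ ⁅ u ⁆)) (∣⁅x⁆∣≡1 u))
∣pair∣≡2 {u = suc u} {suc w} u≢w = ∣pair∣≡2 (u≢w ∘ cong suc)

2≤∣D∣ : ∀ {p} {D : Subset p} {u w} → u ∈ D → w ∈ D → u ≢ w → 2 ≤ ∣ D ∣
2≤∣D∣ {D = D} {u} {w} u∈ w∈ u≢w = subst (_≤ ∣ D ∣) (∣pair∣≡2 u≢w)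
  (p⊆q⇒∣p∣≤∣q∣ {p = pair u w} {q = D}
    (λ x∈ → [ (λ { refl → u∈ }) , (λ { refl → w∈ }) ]′ (∈-pair⁻ x∈)))

∣D∣≡2⇒⊆pair : ∀ {p} {D : Subset p} {r} → ∣ D ∣ ≡ 2 → r ∈ D →
              ∃[ s ] (∀ {x} → x ∈ D → x ≡ r ⊎ x ≡ s)
∣D∣≡2⇒⊆pair {D = D} {r} size r∈ with any? (λ s → (s ∈? D) ×-dec ¬? (s ≟ r))
-- A default: when `D` holds nothing but `r`, the choice `s = r` already covers it, which saves
-- refuting this case by the size.
... | no none = r , λ {x} x∈ → inj₁ (decidable-stable (x ≟ r) λ x≢r → none (x , x∈ , x≢r))
... | yes (s , s∈ , s≢r) = s , λ {x} → inPair x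
  where
  pair⊆D : ∀ {x} → x ∈ pair r s → x ∈ D
  pair⊆D x∈ = [ (λ { refl → r∈ }) , (λ { refl → s∈ }) ]′ (∈-pair⁻ x∈)

  inPair : ∀ x → x ∈ D → x ≡ r ⊎ x ≡ s
  inPair x x∈ with x ∈? pair r s
  ... | yes x∈pair = ∈-pair⁻ x∈pair
  -- A vertex of `D` outside the pair would make the pair a proper subset, so `D` would have more
  -- than two elements.
  ... | no  x∉pair = contradiction
    (≤-reflexive (trans size (sym (∣pair∣≡2 (s≢r ∘ sym)))))
    (<⇒≱ (p⊂q⇒∣p∣<∣q∣ (pair⊆D , x , x∈ , x∉pair)))

-- Mates and their transport along isomorphisms.

Dominates : {V : Set} → Graph V → V → V → Set
Dominates G u w = ∀ x → x ≢ u → x ≢ w → Adj G x u ⊎ Adj G x w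

-- What membership in `ℭ` is used for. The `mate` yields a dominating pair across the two sides at
-- every vertex. The `twin` is there for the lower bound: adjacent vertices lie on different sides,
-- so one guard cannot dominate its own twin.
record Mated {V : Set} (G : Graph V) : Set where
  field
    side      : V → Bool
    bipartite : ∀ {u v} → Adj G u v → side u ≢ side v
    mate      : V → V
    mate-side : ∀ v → side v ≢ side (mate v)
    mate-dom  : ∀ v → Dominates G v (mate v)
    twin      : V → V
    twin-side : ∀ v → side (twin v) ≡ side v
    twin≢     : ∀ v → twin v ≢ v

Mated-≅ : {V W : Set} {G : Graph V} {H : Graph W} → G ≅ H → Mated H → Mated G
Mated-≅ {V} {W} {G} {H} (φ , φ-adj) M = record
  { side      = side ∘ to
  ; bipartite = λ {u} {v} uv → bipartite (Equivalence.to (φ-adj u v) uv)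
  ; mate      = from ∘ mate ∘ to
  ; mate-side = λ v eq → mate-side (to v) (trans eq (cong side (to∘from (mate (to v)))))
  ; mate-dom  = λ v x x≢v x≢m → Sum.map (Equivalence.from (φ-adj x v))
      (λ a → Equivalence.from (φ-adj x _) (subst (Adj H (to x)) (sym (to∘from _)) a))
      (mate-dom (to v) (to x) (x≢v ∘ injective)
        (λ eq → x≢m (injective (trans eq (sym (to∘from _))))))
  ; twin      = from ∘ twin ∘ to
  ; twin-side = λ v → trans (cong side (to∘from _)) (twin-side (to v))
  ; twin≢     = λ v eq → twin≢ (to v) (trans (sym (to∘from _)) (cong to eq))
  }
  where
  open Mated M
  open Bijection φ using (to; injective; surjective)
  from : W → V
  from = proj₁ ∘ surjective
  to∘from : ∀ w → to (from w) ≡ w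
  to∘from w = proj₂ (surjective w) refl

≢-≢⇒≡ : ∀ {a b c : Bool} → a ≢ b → c ≢ b → a ≡ c
≢-≢⇒≡ a≢b c≢b = trans (¬-not a≢b) (sym (¬-not c≢b))

-- Two guards on a mated graph.

module _ {p : ℕ} (G : Graph (Fin p)) where

  move-pair : ∀ {u w r s} → u ≢ w → r ≢ s → Adj G u r → s ≡ w ⊎ Adj G w s →
              Move G (pair u w) (pair r s)
  move-pair {u} {w} {r} {s} u≢w r≢s ur ws = record
    { same-size = trans (∣pair∣≡2 r≢s) (sym (∣pair∣≡2 u≢w))
    ; move      = mk⤖ {to = to} (to-injective , to-surjective)
    ; step      = to-step
    }
    where
    to : ∃[ v ] v ∈ pair u w → ∃[ v ] v ∈ pair r s
    to (x , _) with x ≟ u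
    ... | yes _ = r , ∈-pairˡ
    ... | no  _ = s , ∈-pairʳ

    ≡w : ∀ {x} → x ∈ pair u w → x ≢ u → x ≡ w
    ≡w x∈ x≢u = [ (λ x≡u → contradiction x≡u x≢u) , id ]′ (∈-pair⁻ x∈)

    ∃-≡ : ∀ {D : Subset p} {x y} {x∈ : x ∈ D} {y∈ : y ∈ D} → x ≡ y →
          _≡_ {A = ∃[ v ] v ∈ D} (x , x∈) (y , y∈)
    -- Membership proofs are irrelevant, so a guard is determined by its vertex.
    ∃-≡ refl = cong (_ ,_) ([]=-irrelevant _ _)

    to-injective : ∀ {g h} → to g ≡ to h → g ≡ h
    to-injective {x , x∈} {y , y∈} eq with x ≟ u | y ≟ u
    ... | yes x≡u | yes y≡u = ∃-≡ (trans x≡u (sym y≡u))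
    ... | yes _   | no  _   = contradiction (cong proj₁ eq) r≢s
    ... | no  _   | yes _   = contradiction (sym (cong proj₁ eq)) r≢s
    ... | no  x≢u | no  y≢u = ∃-≡ (trans (≡w x∈ x≢u) (sym (≡w y∈ y≢u)))

    to-u : ∀ {u∈} → proj₁ (to (u , u∈)) ≡ r
    to-u with u ≟ u
    ... | yes _   = refl
    ... | no  u≢u = contradiction refl u≢u

    to-w : ∀ {w∈} → proj₁ (to (w , w∈)) ≡ s
    to-w with w ≟ u
    ... | yes w≡u = contradiction (sym w≡u) u≢w
    ... | no  _   = refl

    to-surjective : ∀ h → ∃[ g ] (∀ {z} → z ≡ g → to z ≡ h)
    to-surjective (y , y∈) with ∈-pair⁻ y∈
    ... | inj₁ y≡r = (u , ∈-pairˡ) , λ { refl → ∃-≡ (trans to-u (sym y≡r)) }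
    ... | inj₂ y≡s = (w , ∈-pairʳ) , λ { refl → ∃-≡ (trans to-w (sym y≡s)) }

    to-step : ∀ g → proj₁ (to g) ≡ proj₁ g ⊎ Adj G (proj₁ g) (proj₁ (to g))
    to-step (x , x∈) with x ≟ u
    ... | yes refl = inj₂ ur
    ... | no  x≢u with refl ← ≡w x∈ x≢u = ws

  dominates⇒dominating : ∀ {u w} → Dominates G u w → Dominating G (pair u w)
  dominates⇒dominating dom x x∉ =
    [ (λ a → _ , ∈-pairˡ , a) , (λ a → _ , ∈-pairʳ , a) ]′
    (dom x (λ { refl → x∉ ∈-pairˡ }) (λ { refl → x∉ ∈-pairʳ }))

  module _ (M : Mated G) where

    open Mated M

    guards : Fin p → Subset p
    guards v = pair v (mate v)

    mate≢ : ∀ v → v ≢ mate v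
    mate≢ v = mate-side v ∘ cong side

    -- The guard on u is the one that answers the attack on r; the other guard
    -- is on the side of r and must reach the mate of r, which dominates that
    -- side except for r itself.
    reach : ∀ {u w r} → side u ≢ side w → r ≢ w → Adj G r u → Move G (pair u w) (guards r)
    reach {u} {w} {r} u≢w r≢w ru =
      move-pair (u≢w ∘ cong side) (mate≢ r) (Graph.sym G ru) other
      where
      w-r-side : side r ≡ side w
      w-r-side = ≢-≢⇒≡ (bipartite ru) (u≢w ∘ sym)

      other : mate r ≡ w ⊎ Adj G w (mate r)
      other with mate r ≟ w
      ... | yes eq = inj₁ eq
      ... | no  m≢w with mate-dom r w (r≢w ∘ sym) (m≢w ∘ sym)
      ...   | inj₁ wr = contradiction (sym w-r-side) (bipartite wr)
      ...   | inj₂ wm = inj₂ wm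

    -- An unoccupied `r` is adjacent to one of the two guards, and that guard answers the attack.
    answer : ∀ v r → r ∉ guards v → Move G (guards v) (guards r)
    answer v r r∉ with mate-dom v r (λ { refl → r∉ ∈-pairˡ }) (λ { refl → r∉ ∈-pairʳ })
    ... | inj₁ rv = reach (mate-side v) (λ { refl → r∉ ∈-pairʳ }) rv
    -- Here the guard on `mate v` moves to `r`, so the pair is read in the other order.
    ... | inj₂ rm = subst (λ D → Move G D (guards r)) (∪-comm ⁅ mate v ⁆ ⁅ v ⁆)
      (reach (mate-side v ∘ sym) (λ { refl → r∉ ∈-pairˡ }) rm)

    last : Fin p → List (Fin p) → Fin p
    last v []      = v
    last v (r ∷ _) = r

    -- The position depends on the last attack alone; before the first attack, `v` plays that part.
    mated⇒eternal : ∀ v → MEternalDominating G (guards v)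
    mated⇒eternal v = record
      { strategy   = guards ∘ last v
      ; start      = refl
      ; dominating = λ {h} _ → dominates⇒dominating (mate-dom (last v h))
      ; occupy     = λ _ _ → ∈-pairˡ
      ; respond    = λ {h} {r} _ → answer (last v h) r
      }

    -- The given vertex makes the graph nonempty, so `D` has an element `u`. If the twin of `u` is
    -- not in `D`, it has a neighbour in `D`, which lies on the other side and so differs from `u`.
    dominating⇒2≤ : Fin p → ∀ {D} → Dominating G D → 2 ≤ ∣ D ∣
    dominating⇒2≤ v {D} dom = two (case v ∈? D of λ where
      (yes v∈) → v , v∈
      (no v∉)  → let u , u∈ , _ = dom v v∉ in u , u∈)
      where
      two : ∃[ u ] u ∈ D → 2 ≤ ∣ D ∣
      two (u , u∈) with twin u ∈? D
      ... | yes t∈ = 2≤∣D∣ u∈ t∈ (twin≢ u ∘ sym)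
      ... | no  t∉ with dom (twin u) t∉
      ...   | w , w∈ , tw = 2≤∣D∣ u∈ w∈ λ { refl → bipartite tw (twin-side u) }

  eternal⇒dominating : ∀ {D} → MEternalDominating G D → Dominating G D
  eternal⇒dominating E = subst (Dominating G) start (dominating [])
    where open MEternalDominating E

  mated⇒numbers : Mated G → Fin p → γ G 2 × γₘ^∞ G 2
  mated⇒numbers M v =
    ((guards M v , eternal⇒dominating (mated⇒eternal M v) , size) ,
      λ _ → dominating⇒2≤ M v) ,
    ((guards M v , mated⇒eternal M v , size) ,
      λ _ → dominating⇒2≤ M v ∘ eternal⇒dominating)
    where
    size : ∣ guards M v ∣ ≡ 2
    size = ∣pair∣≡2 (mate≢ M v)

-- Mates from a deleted matching.

-- For a matching with edges E and ends f, g : Fin m, Fin n, this says that i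
-- and j are matched to each other or both unmatched.
Partners : {m n : ℕ} {E : Set} (f : E → Fin m) (g : E → Fin n) → List E → Fin m → Fin n → Set
Partners f g N i j = ∀ {e} → e ∈ₗ N → f e ≡ i ⇔ g e ≡ j

-- For a matched `i`, its edge decides `j`. An unmatched `i` shows that the matching does not cover
-- the first side; by `room` it does not cover the second either, and any unmatched `j` will do.
partner : ∀ {m n} {E : Set} {f : E → Fin m} {g : E → Fin n} {N} →
          Unique (map f N) → Unique (map g N) → (length N < m → length N < n) →
          ∀ i → ∃[ j ] Partners f g N i j
partner {m} {n} {f = f} {g} {N} f-uniq g-uniq room i with i ∈ₗ? map f N
... | yes i∈ with e , e∈ , refl ← ∈-map⁻ f i∈ = g e , λ e′∈ → mk⇔
  (cong g ∘ image-injective f-uniq e′∈ e∈) (cong f ∘ image-injective g-uniq e′∈ e∈)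
... | no i∉ = j , λ e∈ → mk⇔
  (λ fe≡i → contradiction (subst (_∈ₗ map f N) fe≡i (∈-map⁺ f e∈)) i∉)
  (λ ge≡j → contradiction (subst (_∈ₗ map g N) ge≡j (∈-map⁺ g e∈)) j∉)
  where
  free : ∃[ j ] j ∉ₗ map g N
  free = ∃-∉ (map g N) (subst (_< n) (sym (length-map g N))
    (room (subst (_< m) (length-map f N) (unique-∉⇒length< f-uniq i∉))))
  j  = proj₁ free
  j∉ = proj₂ free

Edges : ℕ → ℕ → Set
Edges m n = List ((Fin m ⊎ Fin n) × (Fin m ⊎ Fin n))

module _ {m n : ℕ} where

  orient : ∀ {M : Edges m n} → All (λ (a , b) → KAdj a b) M → List (Fin m × Fin n)
  orient []                = []
  orient (l-r {i} {j} ∷ M) = (i , j) ∷ orient M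
  orient (r-l {i} {j} ∷ M) = (i , j) ∷ orient M

  length-orient : ∀ {M : Edges m n} (E : All (λ (a , b) → KAdj a b) M) →
                  length (orient E) ≡ length M
  length-orient []        = refl
  length-orient (l-r ∷ E) = cong suc (length-orient E)
  length-orient (r-l ∷ E) = cong suc (length-orient E)

  ∈-orient⁺ : ∀ {M : Edges m n} (E : All (λ (a , b) → KAdj a b) M) {i j} →
              (inj₁ i , inj₂ j) ∈ₗ M ⊎ (inj₂ j , inj₁ i) ∈ₗ M → (i , j) ∈ₗ orient E
  ∈-orient⁺ (l-r ∷ E) (inj₁ (here refl)) = here refl
  ∈-orient⁺ (l-r ∷ E) (inj₁ (there e∈))  = there (∈-orient⁺ E (inj₁ e∈))
  ∈-orient⁺ (l-r ∷ E) (inj₂ (there e∈))  = there (∈-orient⁺ E (inj₂ e∈))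
  ∈-orient⁺ (r-l ∷ E) (inj₂ (here refl)) = here refl
  ∈-orient⁺ (r-l ∷ E) (inj₁ (there e∈))  = there (∈-orient⁺ E (inj₁ e∈))
  ∈-orient⁺ (r-l ∷ E) (inj₂ (there e∈))  = there (∈-orient⁺ E (inj₂ e∈))

  DisjointEnds : Fin m × Fin n → Fin m × Fin n → Set
  DisjointEnds (i , j) (i′ , j′) = i ≢ i′ × j ≢ j′

  -- The sum records in which order the edge between `i` and `j` was listed. `Disjoint` compares all
  -- ends, so the two inequalities wanted are present for either order of either edge.
  orient-all : ∀ {i j} {M : Edges m n} (E : All (λ (a , b) → KAdj a b) M) →
               All (Disjoint (inj₁ i , inj₂ j)) M ⊎ All (Disjoint (inj₂ j , inj₁ i)) M →
               All (DisjointEnds (i , j)) (orient E)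
  orient-all []        _ = []
  orient-all (l-r ∷ E) (inj₁ (((i≢ , _) , (_ , j≢)) ∷ D)) =
    (i≢ ∘ cong inj₁ , j≢ ∘ cong inj₂) ∷ orient-all E (inj₁ D)
  orient-all (r-l ∷ E) (inj₁ (((_ , i≢) , (j≢ , _)) ∷ D)) =
    (i≢ ∘ cong inj₁ , j≢ ∘ cong inj₂) ∷ orient-all E (inj₁ D)
  orient-all (l-r ∷ E) (inj₂ (((_ , j≢) , (i≢ , _)) ∷ D)) =
    (i≢ ∘ cong inj₁ , j≢ ∘ cong inj₂) ∷ orient-all E (inj₂ D)
  orient-all (r-l ∷ E) (inj₂ (((j≢ , _) , (_ , i≢)) ∷ D)) =
    (i≢ ∘ cong inj₁ , j≢ ∘ cong inj₂) ∷ orient-all E (inj₂ D)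

  orient-disjoint : ∀ {M : Edges m n} (E : All (λ (a , b) → KAdj a b) M) →
                    AllPairs Disjoint M → AllPairs DisjointEnds (orient E)
  orient-disjoint []        _       = []
  orient-disjoint (l-r ∷ E) (d ∷ D) = orient-all E (inj₁ d) ∷ orient-disjoint E D
  orient-disjoint (r-l ∷ E) (d ∷ D) = orient-all E (inj₂ d) ∷ orient-disjoint E D

another : ∀ {n} → 2 ≤ n → (i : Fin n) → ∃[ j ] j ≢ i
another 2≤n i with j , j∉ ← ∃-∉ (i ∷ []) 2≤n = j , λ j≡i → j∉ (here j≡i)

-- The equivalence of the two inequalities says that the matching covers both sides or neither,
-- which is what the two constructors of `ℭ` have in common.
K-mated : ∀ {m n} (M : Edges m n) → 2 ≤ m → 2 ≤ n →
          IsMatching (K m n) M → length M < m ⇔ length M < n → Mated (K[ m , n ]- M)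
K-mated {m} {n} M 2≤m 2≤n (E , D) room = record
  { side      = λ { (inj₁ _) → false ; (inj₂ _) → true }
  ; bipartite = λ { (l-r , _) () ; (r-l , _) () }
  ; mate      = λ { (inj₁ i) → inj₂ (proj₁ (right i)) ; (inj₂ j) → inj₁ (proj₁ (left j)) }
  ; mate-side = λ { (inj₁ _) () ; (inj₂ _) () }
  ; mate-dom  = λ where
      (inj₁ i) → dom (λ e∈ → proj₂ (right i) e∈)
      -- Flipped, the partner relation from right to left becomes the one from left to right, so
      -- `dom` serves both; only the order of the pair changes.
      (inj₂ j) x x≢ x≢′ → Sum.swap (dom (λ e∈ → flip⇔ (proj₂ (left j) e∈)) x x≢′ x≢)
  ; twin      = λ where
      (inj₁ i) → inj₁ (proj₁ (another 2≤m i))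
      (inj₂ j) → inj₂ (proj₁ (another 2≤n j))
  ; twin-side = λ { (inj₁ _) → refl ; (inj₂ _) → refl }
  ; twin≢     = λ where
      (inj₁ i) → proj₂ (another 2≤m i) ∘ inj₁-injective
      (inj₂ j) → proj₂ (another 2≤n j) ∘ inj₂-injective
  }
  where
  N : List (Fin m × Fin n)
  N = orient E

  ends : AllPairs DisjointEnds N
  ends = orient-disjoint E D

  uniqueˡ : Unique (map proj₁ N)
  uniqueˡ = AllPairs.map⁺ (AllPairs.map proj₁ ends)

  uniqueʳ : Unique (map proj₂ N)
  uniqueʳ = AllPairs.map⁺ (AllPairs.map proj₂ ends)

  room′ : length N < m ⇔ length N < n
  room′ = subst (λ l → l < m ⇔ l < n) (sym (length-orient E)) room

  flip⇔ : {A B : Set} → A ⇔ B → B ⇔ A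
  flip⇔ e = mk⇔ (Equivalence.from e) (Equivalence.to e)

  right : ∀ i → ∃[ j ] Partners proj₁ proj₂ N i j
  right = partner uniqueˡ uniqueʳ (Equivalence.to room′)

  left : ∀ j → ∃[ i ] Partners proj₂ proj₁ N j i
  left = partner uniqueʳ uniqueˡ (Equivalence.from room′)

  adjacent : ∀ {i j} → (i , j) ∉ₗ N → Adj (K[ m , n ]- M) (inj₁ i) (inj₂ j)
  adjacent ∉N = l-r , ∉N ∘ ∈-orient⁺ E ∘ inj₁ , ∉N ∘ ∈-orient⁺ E ∘ inj₂

  dom : ∀ {i j} → Partners proj₁ proj₂ N i j → Dominates (K[ m , n ]- M) (inj₁ i) (inj₂ j)
  -- If `i′` and `j` were matched in `N`, the left end `i′` would have to be the partner `i` of `j`.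
  dom good (inj₁ i′) x≢i _ =
    inj₂ (adjacent λ e∈ → x≢i (cong inj₁ (Equivalence.from (good e∈) refl)))
  dom good (inj₂ j′) _ x≢j = inj₁ (Graph.sym (K[ m , n ]- M)
    (adjacent λ e∈ → x≢j (cong inj₂ (Equivalence.to (good e∈) refl))))

ℭ⇒mated : {V : Set} {G : Graph V} → ℭ G → Mated G
ℭ⇒mated (equal m k M 2≤m _ matching _ iso) =
  Mated-≅ iso (K-mated M 2≤m 2≤m matching (mk⇔ id id))
-- Matching on a successor makes `∸ 1` compute, so the bound on `ℓ` says that the matching covers
-- neither side.
ℭ⇒mated (unequal (suc m) n ℓ M 2≤m m<n ℓ≤m-1 matching refl iso) =
  Mated-≅ iso (K-mated M 2≤m (≤-trans 2≤m (<⇒≤ m<n)) matching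
    (mk⇔ (λ ℓ<m → <-≤-trans ℓ<m (<⇒≤ m<n)) (λ _ → s≤s ℓ≤m-1)))

-- Transport along isomorphisms and bijections.

ℭ-≅ : {V W : Set} {G : Graph V} {H : Graph W} → G ≅ H → ℭ H → ℭ G
ℭ-≅ {V} {W} {G} {H} (φ , φ-adj) = λ where
    (equal m k M 2≤m k≤m matching size iso) →
      equal m k M 2≤m k≤m matching size (compose (K[ m , m ]- M) iso)
    (unequal m n ℓ M 2≤m m<n ℓ≤m-1 matching size iso) →
      unequal m n ℓ M 2≤m m<n ℓ≤m-1 matching size (compose (K[ m , n ]- M) iso)
  where
  compose : ∀ {U : Set} (F : Graph U) → H ≅ F → G ≅ F
  compose _ (ψ , ψ-adj) = ψ ⤖-∘ φ , λ u v → ψ-adj _ _ ⇔-∘ φ-adj u v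

pullback : {V W : Set} → (W → V) → Graph V → Graph W
pullback f G = record
  { Adj    = λ u v → Adj G (f u) (f v)
  ; adj?   = λ u v → adj? G (f u) (f v)
  ; sym    = Graph.sym G
  ; irrefl = irrefl G ∘ cong f
  }

-- All that the forward direction takes from the game. The vertex `s` may equal `r`.
Extendable : {V : Set} → Graph V → Set
Extendable G = ∀ r → ∃[ s ] Dominates G r s

-- This is what γ > 1 provides: no vertex dominates alone.
NoUniversal : {V : Set} → Graph V → Set
NoUniversal G = ∀ v → ¬ (∀ x → x ≢ v → Adj G x v)

module _ {V W : Set} (φ : V ↔ W) (G : Graph V) where

  open Inverse φ using (to; from; strictlyInverseˡ; strictlyInverseʳ)

  private
    H : Graph W
    H = pullback from G

    from≢ : ∀ {x w} → x ≢ w → from x ≢ from w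
    from≢ x≢w eq = x≢w (trans (sym (strictlyInverseˡ _)) (trans (cong to eq) (strictlyInverseˡ _)))

    ≢to : ∀ {x v} → x ≢ to v → from x ≢ v
    ≢to x≢ eq = x≢ (trans (sym (strictlyInverseˡ _)) (cong to eq))

  pullback-≅ : G ≅ H
  pullback-≅ = ↔⇒⤖ φ , λ u v → mk⇔
    (subst₂ (Adj G) (sym (strictlyInverseʳ u)) (sym (strictlyInverseʳ v)))
    (subst₂ (Adj G) (strictlyInverseʳ u) (strictlyInverseʳ v))

  pullback-extendable : Extendable G → Extendable H
  pullback-extendable ext r with s , dom ← ext (from r) = to s , λ x x≢r x≢s →
    Sum.map₂ (subst (Adj G (from x)) (sym (strictlyInverseʳ s)))
      (dom (from x) (from≢ x≢r) (≢to x≢s))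

  pullback-noUniversal : NoUniversal G → NoUniversal H
  pullback-noUniversal none w univ = none (from w) λ x x≢ →
    subst (λ y → Adj G y (from w)) (strictlyInverseʳ x)
      (univ (to x) λ eq → x≢ (trans (sym (strictlyInverseʳ x)) (cong from eq)))

-- An isolated vertex v belongs to every dominating set, so the pair extending x
-- is {x, v}, and it misses y.
no-isolated : {V : Set} {G : Graph V} → DecidableEquality V → Extendable G →
              ∀ {v x y} → (∀ u → ¬ Adj G v u) → x ≢ v → y ≢ v → y ≢ x → ¬ ¬ Adj G y x
no-isolated {G = G} _≟ᵥ_ ext {v} {x} {y} isolated x≢v y≢v y≢x y≁x with ext x
... | s , dom with v ≟ᵥ s
...   | no v≢s   = [ isolated x , isolated s ]′ (dom v (x≢v ∘ sym) v≢s)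
...   | yes refl = [ y≁x , isolated y ∘ Graph.sym G ]′ (dom y y≢x y≢v)

two-cover : ∀ {n} → n ≤ 2 → {i j : Fin n} → i ≢ j → ∀ k → k ≡ i ⊎ k ≡ j
two-cover n≤2 {i} {j} i≢j k with k ≟ i | k ≟ j
... | yes k≡i | _       = inj₁ k≡i
... | no  _   | yes k≡j = inj₂ k≡j
... | no  k≢i | no  k≢j =
  contradiction n≤2 (<⇒≱ (unique⇒length≤ ((k≢i ∷ k≢j ∷ []) ∷ (i≢j ∷ []) ∷ [] ∷ [])))

-- Extendable graphs on two given sides.

module _ {m n : ℕ} (H : Graph (Fin m ⊎ Fin n))
         (noLL : ∀ {i i′} → ¬ Adj H (inj₁ i) (inj₁ i′))
         (noRR : ∀ {j j′} → ¬ Adj H (inj₂ j) (inj₂ j′)) where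

  _~_ : Fin m → Fin n → Set
  i ~ j = Adj H (inj₁ i) (inj₂ j)

  _~?_ = λ i j → adj? H (inj₁ i) (inj₂ j)

  record NonEdgesMatching : Set where
    field
      row : ∀ {i j j′} → ¬ i ~ j → ¬ i ~ j′ → j ≡ j′
      col : ∀ {i i′ j} → ¬ i ~ j → ¬ i′ ~ j → i ≡ i′

  nonEdges : List (Fin m × Fin n)
  nonEdges = filter (λ (i , j) → ¬? (i ~? j)) (cartesianProduct (allFin m) (allFin n))

  ∈-nonEdges⁺ : ∀ {i j} → ¬ i ~ j → (i , j) ∈ₗ nonEdges
  ∈-nonEdges⁺ = ∈-filter⁺ _ (∈-cartesianProduct⁺ (∈-allFin _) (∈-allFin _))

  ∈-nonEdges⁻ : ∀ {i j} → (i , j) ∈ₗ nonEdges → ¬ i ~ j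
  ∈-nonEdges⁻ e∈ = proj₂ (∈-filter⁻ _ {xs = cartesianProduct (allFin m) (allFin n)} e∈)

  nonEdges-unique : Unique nonEdges
  nonEdges-unique = Unique.filter⁺ _
    (Unique.cartesianProduct⁺ (Unique.allFin⁺ m) (Unique.allFin⁺ n))

  edge : Fin m × Fin n → (Fin m ⊎ Fin n) × (Fin m ⊎ Fin n)
  edge (i , j) = inj₁ i , inj₂ j

  removed : Edges m n
  removed = map edge nonEdges

  H-adj : ∀ u v → Adj H u v ⇔ Adj (K[ m , n ]- removed) u v
  H-adj = λ where
      (inj₁ _) (inj₁ _) → mk⇔ (λ a → contradiction a noLL) (λ ())
      (inj₁ i) (inj₂ j) → mk⇔ keep unkeep
      (inj₂ j) (inj₁ i) → mk⇔ (Graph.sym (K[ m , n ]- removed) ∘ keep ∘ Graph.sym H)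
                              (Graph.sym H ∘ unkeep ∘ Graph.sym (K[ m , n ]- removed))
      (inj₂ _) (inj₂ _) → mk⇔ (λ a → contradiction a noRR) (λ ())
    where
    keep : ∀ {i j} → i ~ j → Adj (K[ m , n ]- removed) (inj₁ i) (inj₂ j)
    keep {i} {j} a = l-r ,
      (λ e∈ → case ∈-map⁻ edge e∈ of λ { (_ , e∈′ , refl) → ∈-nonEdges⁻ e∈′ a }) ,
      (λ e∈ → case ∈-map⁻ edge e∈ of λ { (_ , _ , ()) })

    unkeep : ∀ {i j} → Adj (K[ m , n ]- removed) (inj₁ i) (inj₂ j) → i ~ j
    unkeep {i} {j} (_ , ∉ , _) =
      decidable-stable (i ~? j) λ i≁j → ∉ (∈-map⁺ edge (∈-nonEdges⁺ i≁j))

  module _ (Q : NonEdgesMatching) where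

    open NonEdgesMatching Q

    removed-matching : IsMatching (K m n) removed
    removed-matching = All.map⁺ (All.tabulate λ _ → l-r) ,
      AllPairs.map⁺ (unique⇒allPairs nonEdges-unique λ { {i , j} {i′ , j′} e∈ e∈′ e≢e′ →
        ((λ { refl → e≢e′ (cong (i ,_) (row (∈-nonEdges⁻ e∈) (∈-nonEdges⁻ e∈′))) }) , λ ()) ,
        ((λ ()) , (λ { refl → e≢e′ (cong (_, j) (col (∈-nonEdges⁻ e∈) (∈-nonEdges⁻ e∈′))) })) })

    lefts-unique : Unique (map proj₁ nonEdges)
    lefts-unique = AllPairs.map⁺ (unique⇒allPairs nonEdges-unique λ { {i , j} e∈ e∈′ e≢e′ refl →
      e≢e′ (cong (i ,_) (row (∈-nonEdges⁻ e∈) (∈-nonEdges⁻ e∈′))) })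

    length-removed : {A : Set} (f : Fin m × Fin n → A) → length (map f nonEdges) ≡ length removed
    length-removed f = trans (length-map f nonEdges) (sym (length-map edge nonEdges))

    removed≤m : length removed ≤ m
    removed≤m = subst (_≤ m) (length-removed proj₁) (unique⇒length≤ lefts-unique)

    -- There are at most `m` non-edges and `m < n`, so some `j` lies on none. The `i` obtained from
    -- `full j` can have only `j` as a non-neighbour on the right, so `i` lies on none either and
    -- the left ends miss it.
    removed<m : m < n → (∀ j → ∃[ i ] (∀ j′ → j′ ≢ j → i ~ j′)) → length removed < m
    removed<m m<n full = subst (_< m) (length-removed proj₁)
      (unique-∉⇒length< lefts-unique i∉)
      where
      unmatched : ∃[ j ] j ∉ₗ map proj₂ nonEdges
      unmatched = ∃-∉ (map proj₂ nonEdges) 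
        (subst (_< n) (sym (length-removed proj₂)) (≤-<-trans removed≤m m<n))
      j = proj₁ unmatched
      i = proj₁ (full j)

      i∉ : i ∉ₗ map proj₁ nonEdges
      i∉ i∈ with ∈-map⁻ proj₁ i∈
      ... | (_ , j′) , e∈ , refl = ∈-nonEdges⁻ e∈ (proj₂ (full j) j′
        λ { refl → proj₂ unmatched (∈-map⁺ proj₂ e∈) })

    nonEdgesMatching⇒ℭ : 2 ≤ m → m ≤ n →
                         (m < n → ∀ j → ∃[ i ] (∀ j′ → j′ ≢ j → i ~ j′)) → ℭ H
    nonEdgesMatching⇒ℭ 2≤m m≤n full = [ less , same ]′ (m≤n⇒m<n∨m≡n m≤n)
      where
      less : m < n → ℭ H
      -- Subtracting 1 on both sides of `suc ℓ ≤ m` gives the bound `ℓ ≤ m ∸ 1`.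
      less m<n = unequal m n _ removed 2≤m m<n (∸-monoˡ-≤ 1 (removed<m m<n (full m<n)))
        removed-matching refl (⤖-id _ , H-adj)

      same : m ≡ n → ℭ H
      same refl = equal m _ removed 2≤m removed≤m removed-matching refl (⤖-id _ , H-adj)

  module _ (ext : Extendable H) where

    -- If the vertex paired with `j` were also on the right, a third right vertex would have no
    -- neighbour in the pair.
    opposite : 3 ≤ n → ∀ j → ∃[ i ] Dominates H (inj₂ j) (inj₁ i)
    opposite 3≤n j with ext (inj₂ j)
    ... | inj₁ i  , dom = i , dom
    ... | inj₂ j′ , dom with j″ , j″∉ ← ∃-∉ (j ∷ j′ ∷ []) 3≤n =
      contradiction
        (dom (inj₂ j″) (λ { refl → j″∉ (here refl) }) (λ { refl → j″∉ (there (here refl)) }))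
        [ noRR , noRR ]′

    fullˡ : 3 ≤ n → ∀ j → ∃[ i ] (∀ j′ → j′ ≢ j → i ~ j′)
    fullˡ 3≤n j with i , dom ← opposite 3≤n j = i , λ j′ j′≢j →
      [ (λ a → contradiction a noRR) , Graph.sym H ]′
      (dom (inj₂ j′) (j′≢j ∘ inj₂-injective) λ ())

    -- Every non-neighbour of j is the vertex i of a dominating pair {i, j}, and
    -- the only non-neighbour of such an i can be j.
    opposite⇒matching : 3 ≤ n → NonEdgesMatching
    opposite⇒matching 3≤n = record
      { row = λ {i} {j} {j′} i≁j i≁j′ → decidable-stable (j ≟ j′) λ j≢j′ →
          let i′ , full = fullˡ 3≤n j in
          i≁j′ (subst (_~ j′) (sym (nonNeighbour i≁j)) (full j′ (j≢j′ ∘ sym)))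
      ; col = λ i≁j i′≁j → trans (nonNeighbour i≁j) (sym (nonNeighbour i′≁j))
      }
      where
      nonNeighbour : ∀ {i j} → ¬ i ~ j → i ≡ proj₁ (fullˡ 3≤n j)
      nonNeighbour {i} {j} i≁j with opposite 3≤n j
      ... | i′ , dom = decidable-stable (i ≟ i′) λ i≢i′ →
        [ i≁j , noLL ]′ (dom (inj₁ i) (λ ()) (i≢i′ ∘ inj₁-injective))

    -- If `i₀` were the only left vertex, `fullˡ` applied at some `j′ ≢ j` would make it adjacent to
    -- each `j`, so it would be universal.
    opposite⇒2≤m : NoUniversal H → 3 ≤ n → Fin n → 2 ≤ m
    opposite⇒2≤m none 3≤n j₀ with i₀ , _ ← fullˡ 3≤n j₀ =
      decidable-stable (2 ≤? m) λ 2≰m →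
      let ≡i₀ : ∀ i → i ≡ i₀
          ≡i₀ i = decidable-stable (i ≟ i₀) λ i≢i₀ →
            2≰m (unique⇒length≤ ((i≢i₀ ∷ []) ∷ [] ∷ []))
      in none (inj₁ i₀) λ where
        (inj₁ i) i≢i₀ → contradiction (cong inj₁ (≡i₀ i)) i≢i₀
        (inj₂ j) _    → let j′ , j′≢j = another (<⇒≤ 3≤n) j
                            i , full = fullˡ 3≤n j′
                        in Graph.sym H (subst (_~ j) (≡i₀ i) (full j (j′≢j ∘ sym)))

    -- With at most two vertices opposite, two non-edges at a vertex would isolate it. By
    -- `no-isolated` the two opposite vertices could then not be non-adjacent, although they lie on
    -- one side.
    small⇒matching : m ≤ 2 → n ≤ 2 → NonEdgesMatching
    small⇒matching m≤2 n≤2 = record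
      { row = λ {i} {j} {j′} i≁j i≁j′ → decidable-stable (j ≟ j′) λ j≢j′ →
          no-isolated {G = H} _≟ᵥ_ ext {v = inj₁ i} {x = inj₂ j} {y = inj₂ j′}
            (λ { (inj₁ _) → noLL
               ; (inj₂ k) a → [ (λ { refl → i≁j a }) , (λ { refl → i≁j′ a }) ]′
                              (two-cover n≤2 j≢j′ k) })
            (λ ()) (λ ()) (j≢j′ ∘ sym ∘ inj₂-injective) noRR
      ; col = λ {i} {i′} {j} i≁j i′≁j → decidable-stable (i ≟ i′) λ i≢i′ →
          no-isolated {G = H} _≟ᵥ_ ext {v = inj₂ j} {x = inj₁ i} {y = inj₁ i′}
            (λ { (inj₁ k) a → [ (λ { refl → i≁j (Graph.sym H a) })
                              , (λ { refl → i′≁j (Graph.sym H a) }) ]′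
                              (two-cover m≤2 i≢i′ k)
               ; (inj₂ _) → noRR })
            (λ ()) (λ ()) (i≢i′ ∘ sym ∘ inj₁-injective) noLL
      }
      where _≟ᵥ_ = ≡-dec _≟_ _≟_

    extendable⇒ℭ : NoUniversal H → 4 ≤ m + n → m ≤ n → ℭ H
    extendable⇒ℭ none 4≤m+n m≤n with 3 ≤? n
    -- The pattern `s≤s _` exposes `n` as a successor, so that `zero` is a right vertex.
    ... | yes 3≤n@(s≤s _) = nonEdgesMatching⇒ℭ (opposite⇒matching 3≤n)
      (opposite⇒2≤m none 3≤n zero) m≤n (λ _ → fullˡ 3≤n)
    -- Now `n ≤ 2`, `m ≤ n` and `4 ≤ m + n` force `m = n = 2`, so the condition for `m < n` is
    -- vacuous.
    ... | no  3≰n = nonEdgesMatching⇒ℭ (small⇒matching (≤-trans m≤n n≤2) n≤2)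
      2≤m m≤n (λ m<n → contradiction (≤-trans m<n n≤2) (<⇒≱ (s≤s 2≤m)))
      where
      n≤2 : n ≤ 2
      n≤2 = s≤s⁻¹ (≰⇒> 3≰n)

      2≤m : 2 ≤ m
      2≤m = +-cancelʳ-≤ 2 2 m (≤-trans 4≤m+n (+-monoʳ-≤ m n≤2))

-- Splitting the vertices by side.

split : ∀ {p} (side : Fin p → Bool) → ∃[ m ] ∃[ n ] Σ[ φ ∈ Fin p ↔ (Fin m ⊎ Fin n) ]
        (m + n ≡ p) ×
        (∀ i → side (Inverse.from φ (inj₁ i)) ≡ false) ×
        (∀ j → side (Inverse.from φ (inj₂ j)) ≡ true)
split {zero}  side = 0 , 0 ,
  mk↔ₛ′ (λ ()) [ (λ ()) , (λ ()) ]′ (λ { (inj₁ ()) ; (inj₂ ()) }) (λ ()) ,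
  refl , (λ ()) , (λ ())
split {suc p} side with split (side ∘ suc) | side zero in eq
... | m , n , φ , refl , left , right | false =
  suc m , n , mk↔ₛ′ to′ from′ to∘from from∘to , refl ,
  (λ { zero → eq ; (suc i) → left i }) , right
  where
  open Inverse φ
  to′ : Fin (suc p) → Fin (suc m) ⊎ Fin n
  to′ zero    = inj₁ zero
  to′ (suc x) = Sum.map₁ suc (to x)
  from′ : Fin (suc m) ⊎ Fin n → Fin (suc p)
  from′ (inj₁ zero)    = zero
  from′ (inj₁ (suc i)) = suc (from (inj₁ i))
  from′ (inj₂ j)       = suc (from (inj₂ j))
  to∘from : ∀ y → to′ (from′ y) ≡ y
  to∘from (inj₁ zero)    = refl
  to∘from (inj₁ (suc i)) = cong (Sum.map₁ suc) (strictlyInverseˡ (inj₁ i))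
  to∘from (inj₂ j)       = cong (Sum.map₁ suc) (strictlyInverseˡ (inj₂ j))
  from∘to : ∀ x → from′ (to′ x) ≡ x
  from∘to zero = refl
  from∘to (suc x) with to x | strictlyInverseʳ x
  ... | inj₁ _ | refl = refl
  ... | inj₂ _ | refl = refl
... | m , n , φ , refl , left , right | true =
  m , suc n , mk↔ₛ′ to′ from′ to∘from from∘to , +-suc m n ,
  left , (λ { zero → eq ; (suc j) → right j })
  where
  open Inverse φ
  to′ : Fin (suc p) → Fin m ⊎ Fin (suc n)
  to′ zero    = inj₂ zero
  to′ (suc x) = Sum.map₂ suc (to x)
  from′ : Fin m ⊎ Fin (suc n) → Fin (suc p)
  from′ (inj₂ zero)    = zero
  from′ (inj₂ (suc j)) = suc (from (inj₂ j))
  from′ (inj₁ i)       = suc (from (inj₁ i))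
  to∘from : ∀ y → to′ (from′ y) ≡ y
  to∘from (inj₂ zero)    = refl
  to∘from (inj₂ (suc j)) = cong (Sum.map₂ suc) (strictlyInverseˡ (inj₂ j))
  to∘from (inj₁ i)       = cong (Sum.map₂ suc) (strictlyInverseˡ (inj₁ i))
  from∘to : ∀ x → from′ (to′ x) ≡ x
  from∘to zero = refl
  from∘to (suc x) with to x | strictlyInverseʳ x
  ... | inj₁ _ | refl = refl
  ... | inj₂ _ | refl = refl

-- From the two numbers to the class `ℭ`.

module _ {p : ℕ} (G : Graph (Fin p)) where

  γ≡2⇒noUniversal : γ G 2 → NoUniversal G
  γ≡2⇒noUniversal (_ , least) v univ = contradiction
    (least ⁅ v ⁆ λ x x∉ → v , x∈⁅x⁆ v , univ x λ { refl → x∉ (x∈⁅x⁆ v) })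
    (<⇒≱ (s≤s (≤-reflexive (∣⁅x⁆∣≡1 v))))

  -- If `r` is occupied at the start, the first position is the pair sought; otherwise the response
  -- to an attack on `r` is.
  eternal⇒extendable : γₘ^∞ G 2 → Extendable G
  eternal⇒extendable ((D , E , size) , _) r = extend (case r ∈? strategy [] of λ where
      (yes r∈) → strategy [] , r∈ , dominating [] , size₀
      (no  r∉) → strategy (r ∷ []) , occupy [] r∉ , dominating (r∉ ∷ []) ,
                 trans (Move.same-size (respond [] r∉)) size₀)
    where
    open MEternalDominating E

    size₀ : ∣ strategy [] ∣ ≡ 2
    size₀ = trans (cong ∣_∣ start) size

    extend : ∃[ D′ ] (r ∈ D′ × Dominating G D′ × ∣ D′ ∣ ≡ 2) → ∃[ s ] Dominates G r s
    extend (D′ , r∈ , dom , size′) with s , cover ← ∣D∣≡2⇒⊆pair size′ r∈ = s , λ x x≢r x≢s →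
      let u , u∈ , a = dom x λ x∈ → [ x≢r , x≢s ]′ (cover x∈)
      in Sum.map (λ u≡r → subst (Adj G x) u≡r a) (λ u≡s → subst (Adj G x) u≡s a) (cover u∈)

  bipartite-extendable⇒ℭ : 4 ≤ p → Bipartite G → NoUniversal G → Extendable G → ℭ G
  bipartite-extendable⇒ℭ 4≤p (side , bip) none ext
    with m , n , φ , refl , left , right ← split side | ≤-total m n
  ... | inj₁ m≤n = ℭ-≅ (pullback-≅ φ G) (extendable⇒ℭ (pullback from G)
    (λ a → bip _ _ a (trans (left _) (sym (left _))))
    (λ a → bip _ _ a (trans (right _) (sym (right _))))
    (pullback-extendable φ G ext) (pullback-noUniversal φ G none) 4≤p m≤n)
    where open Inverse φ
  -- The left side has to be the smaller one, so here the two sides are exchanged.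
  ... | inj₂ n≤m = ℭ-≅ (pullback-≅ φ′ G) (extendable⇒ℭ (pullback from G)
    (λ a → bip _ _ a (trans (right _) (sym (right _))))
    (λ a → bip _ _ a (trans (left _) (sym (left _))))
    (pullback-extendable φ′ G ext) (pullback-noUniversal φ′ G none)
    (subst (4 ≤_) (+-comm m n) 4≤p) n≤m)
    where
    φ′ = ⊎-comm (Fin m) (Fin n) ↔-∘ φ
    open Inverse φ′

-- Below four vertices the equivalence can fail: for two isolated vertices, and for an edge with an
-- isolated vertex, both numbers are 2, while every graph in `ℭ` has at least four vertices.
theorem4p3 : (p : ℕ) (G : Graph (Fin p)) → 4 ≤ p → Bipartite G →
    (γ G 2 × γₘ^∞ G 2) ⇔ ℭ G
theorem4p3 (suc p) G 4≤p bip = mk⇔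
  (λ (γ≡2 , γₘ≡2) → bipartite-extendable⇒ℭ G 4≤p bip
    (γ≡2⇒noUniversal G γ≡2) (eternal⇒extendable G γₘ≡2))
  (λ G∈ℭ → mated⇒numbers G (ℭ⇒mated G∈ℭ) zero)
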